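{- For every positive integer $k$, as formal power series in $q$, $$\sum_{n\ge1}\mathrm{spt}k'_{do}(n)\,q^n=T_k(q)\,(q;q^2)_\infty+2q^k(q^2;q^2)_{k-1},$$ where $T_1(q)=-q$ and $T_k(q)=(q-q^{2k-1})T_{k-1}(q)-q^{2k-1}$ for $k>1$.
   Context: For a partition $\pi$, $s(\pi)$ is its smallest part. $\mathrm{Spt}k_{do}(n)$ is the set of partitions $\pi$ of $n$ in which $s(\pi)$ occurs exactly $k$ times and the remaining parts (those larger than $s(\pi)$) are pairwise distinct and each has parity different from that of $s(\pi)$. $B_0(k,n)$ (resp. $B_1(k,n)$) is the number of $\pi\in\mathrm{Spt}k_{do}(n)$ whose number of parts greater than $s(\pi)$ is even (resp. odd), and $\mathrm{spt}k'_{do}(n)=B_0(k,n)-B_1(k,n)$. Notation: $(a;q)_0=1$, $(a;q)_n=\prod_{j=0}^{n-1}(1-aq^j)$, $(a;q)_\infty=\prod_{j\ge0}(1-aq^j)$. -}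

module Defs where

open import Data.Empty using (⊥)
open import Data.Fin.Base using (toℕ)
open import Data.Fin.Properties using (toℕ<n)
open import Data.Integer.Base as ℤ using (ℤ; 0ℤ; 1ℤ)
import Data.Integer.Properties as ℤ
open import Data.List.Base using (List; []; _∷_; length; filter; map; upTo; cartesianProductWith)
open import Data.List.Extrema.Nat using (min)
open import Data.List.Membership.Propositional using (_∈_)
open import Data.List.Membership.Propositional.Properties using (∈-filter⁺; ∈-filter⁻; ∈-cartesianProductWith⁺; ∈-cartesianProductWith⁻; ∈-map⁺; ∈-upTo⁺)
open import Data.List.Properties using (∷-injective)
open import Data.List.Relation.Unary.All as All using (All; []; _∷_; all?)
open import Data.List.Relation.Unary.AllPairs using ([]; _∷_)
open import Data.List.Relation.Unary.Any using (here; there)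
open import Data.List.Relation.Unary.Linked using (Linked; linked?)
open import Data.List.Relation.Unary.Unique.Propositional using (Unique)
import Data.List.Relation.Unary.Unique.Propositional.Properties as Unique
open import Data.Nat.Base using (ℕ; zero; suc; parity; _*_; _∸_; _≤_; _<_; _≥_; z≤n; s≤s)
open import Data.Nat.Properties as ℕ using (_≟_; _≤?_; _<?_; _≥?_)
open import Data.List.Relation.Unary.Unique.DecPropositional _≟_ using (unique?)
open import Data.Nat.ListAction using (sum)
open import Data.Parity.Base using (0ℙ; 1ℙ)
import Data.Parity.Properties as ℙ
open import Data.Product.Base using (_,_; proj₂)
open import Relation.Binary.PropositionalEquality
open import Relation.Nullary using (yes; no; ¬?)
open import Relation.Nullary.Decidable using (map′; _×-dec_)
open import Relation.Unary using (Decidable)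

open import Algebra.Properties.CommutativeMonoid.Sum ℤ.+-0-commutativeMonoid using (sum⁺-syntax; sum-cong-≗; sum-replicate-zero)

record IsPartition (n : ℕ) (π : List ℕ) : Set where
  constructor mkIsPartition
  field
    positive   : All (1 ≤_) π
    decreasing : Linked _≥_ π
    sum≡n      : sum π ≡ n

isPartition? : ∀ n → Decidable (IsPartition n)
isPartition? n π = map′
  (λ (p , d , s) → mkIsPartition p d s)
  (λ (mkIsPartition p d s) → p , d , s)
  (all? (1 ≤?_) π ×-dec linked? _≥?_ π ×-dec (sum π ≟ n))

words : ℕ → ℕ → List (List ℕ)
words m zero    = [] ∷ []
words m (suc l) = [] ∷ cartesianProductWith _∷_ (map suc (upTo m)) (words m l)

-- Every partition of n has at most n parts, each at most n, so each occurs
-- exactly once here: ∈-partitions⁺, ∈-partitions⁻ and partitions-unique.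
partitions : ℕ → List (List ℕ)
partitions n = filter (isPartition? n) (words n n)

-- The value at [] is never used: [] is only a partition of 0.
smallest : List ℕ → ℕ
smallest []      = 0
smallest (p ∷ π) = min p π

multiplicity : ℕ → List ℕ → ℕ
multiplicity p π = length (filter (p ≟_) π)

largerParts : List ℕ → List ℕ
largerParts π = filter (smallest π <?_) π

record InSptDo (k n : ℕ) (π : List ℕ) : Set where
  constructor mkInSptDo
  field
    isPartition     : IsPartition n π
    smallest-k      : multiplicity (smallest π) π ≡ k
    larger-distinct : Unique (largerParts π)
    larger-parity   : All (λ p → parity p ≢ parity (smallest π)) (largerParts π)

inSptDo? : ∀ k n → Decidable (InSptDo k n)
inSptDo? k n π = map′
  (λ (a , b , c , d) → mkInSptDo a b c d)
  (λ (mkInSptDo a b c d) → a , b , c , d)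
  (isPartition? n π
    ×-dec (multiplicity (smallest π) π ≟ k)
    ×-dec unique? (largerParts π)
    ×-dec all? (λ p → ¬? (parity p ℙ.≟ parity (smallest π))) (largerParts π))

SptDo : ℕ → ℕ → List (List ℕ)
SptDo k n = filter (inSptDo? k n) (partitions n)

B₀ : ℕ → ℕ → ℕ
B₀ k n = length (filter (λ π → parity (length (largerParts π)) ℙ.≟ 0ℙ) (SptDo k n))

B₁ : ℕ → ℕ → ℕ
B₁ k n = length (filter (λ π → parity (length (largerParts π)) ℙ.≟ 1ℙ) (SptDo k n))

spt′ : ℕ → ℕ → ℤ
spt′ k n = ℤ.+ B₀ k n ℤ.- ℤ.+ B₁ k n

PowerSeries : Set
PowerSeries = ℕ → ℤ

infix  4 _≈_
infixl 6 _⊕_ _⊖_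
infixl 7 _⊗_ _·_
infix  8 ⊝_
infixr 9 _^^_

_≈_ : PowerSeries → PowerSeries → Set
_≈_ = _≗_

_⊕_ _⊖_ _⊗_ : PowerSeries → PowerSeries → PowerSeries
(f ⊕ g) n = f n ℤ.+ g n
(f ⊖ g) n = f n ℤ.- g n
(f ⊗ g) n = ∑[ i ≤ n ] (f (toℕ i) ℤ.* g (n ∸ toℕ i))

⊝_ : PowerSeries → PowerSeries
(⊝ f) n = ℤ.- f n

_·_ : ℤ → PowerSeries → PowerSeries
(c · f) n = c ℤ.* f n

𝟘 𝟙 q : PowerSeries
𝟘 _       = 0ℤ
𝟙 zero    = 1ℤ
𝟙 (suc _) = 0ℤ
q zero          = 0ℤ
q (suc zero)    = 1ℤ
q (suc (suc _)) = 0ℤ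

_^^_ : PowerSeries → ℕ → PowerSeries
f ^^ zero  = 𝟙
f ^^ suc n = f ⊗ f ^^ n

-- poch a x n = (a;x)ₙ = ∏_{0 ≤ j < n} (1 - a xʲ)
poch : PowerSeries → PowerSeries → ℕ → PowerSeries
poch a x zero    = 𝟙
poch a x (suc n) = (𝟙 ⊖ a ⊗ x ^^ n) ⊗ poch a x n

-- (a;x)_∞ for x with zero constant term: the factors with j > n do not
-- affect the coefficient of qⁿ, so the coefficientwise limit of the
-- partial products is attained at n + 1 factors (poch∞-limit).
poch∞ : PowerSeries → PowerSeries → PowerSeries
poch∞ a x n = poch a x (suc n) n

-- ∑_{n ≥ 1} spt′ k n qⁿ
spt′-series : ℕ → PowerSeries
spt′-series k zero    = 0ℤ
spt′-series k (suc n) = spt′ k (suc n)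

-- Only meaningful for k ≥ 1; the value at 0 is a dummy.
T : ℕ → PowerSeries
T zero            = 𝟘
T (suc zero)      = ⊝ q
T k@(suc (suc j)) = (q ⊖ q ^^ (2 * k ∸ 1)) ⊗ T (suc j) ⊖ q ^^ (2 * k ∸ 1)

words-complete : ∀ m l {π} → All (1 ≤_) π → All (_≤ m) π → length π ≤ l → π ∈ words m l
words-complete m zero    {[]}        _ _ _ = here refl
words-complete m (suc l) {[]}        _ _ _ = here refl
words-complete m (suc l) {suc p ∷ π} (_ ∷ 1≤π) (p<m ∷ π≤m) (s≤s len) =
  there (∈-cartesianProductWith⁺ _∷_ (∈-map⁺ suc (∈-upTo⁺ p<m)) (words-complete m l 1≤π π≤m len))

words-unique : ∀ m l → Unique (words m l)
words-unique m zero    = [] ∷ []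
words-unique m (suc l) =
  All.tabulate (λ w∈ []≡w → []∉ (subst (_∈ _) (sym []≡w) w∈))
  ∷ Unique.cartesianProductWith⁺ _∷_ ∷-injective
      (Unique.map⁺ ℕ.suc-injective (Unique.upTo⁺ m)) (words-unique m l)
  where
  []∉ : [] ∈ cartesianProductWith _∷_ (map suc (upTo m)) (words m l) → ⊥
  []∉ []∈ with ∈-cartesianProductWith⁻ _∷_ (map suc (upTo m)) (words m l) []∈
  ... | _ , _ , _ , _ , ()

length≤sum : ∀ {π} → All (1 ≤_) π → length π ≤ sum π
length≤sum []        = z≤n
length≤sum (p≥1 ∷ a) = ℕ.+-mono-≤ p≥1 (length≤sum a)

parts≤sum : ∀ π → All (_≤ sum π) π
parts≤sum []      = []
parts≤sum (p ∷ π) =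
  ℕ.m≤m+n p (sum π) ∷ All.map (λ le → ℕ.≤-trans le (ℕ.m≤n+m (sum π) p)) (parts≤sum π)

∈-partitions⁺ : ∀ {n π} → IsPartition n π → π ∈ partitions n
∈-partitions⁺ {n} {π} P@(mkIsPartition 1≤π _ refl) =
  ∈-filter⁺ (isPartition? n) (words-complete n n 1≤π (parts≤sum π) (length≤sum 1≤π)) P

∈-partitions⁻ : ∀ {n π} → π ∈ partitions n → IsPartition n π
∈-partitions⁻ {n} π∈ = proj₂ (∈-filter⁻ (isPartition? n) {xs = words n n} π∈)

partitions-unique : ∀ n → Unique (partitions n)
partitions-unique n = Unique.filter⁺ (isPartition? n) (words-unique n n)

∑-zero : ∀ n (f : ℕ → ℤ) → (∀ i → i ≤ n → f i ≡ 0ℤ) → ∑[ i ≤ n ] f (toℕ i) ≡ 0ℤ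
∑-zero n f f≡0 = trans
  (sum-cong-≗ (λ i → f≡0 (toℕ i) (ℕ.≤-pred (toℕ<n i))))
  (sum-replicate-zero (suc n))

^^-order : ∀ x → x 0 ≡ 0ℤ → ∀ j {m} → m < j → (x ^^ j) m ≡ 0ℤ
^^-order x x₀≡0 (suc j) {m} (s≤s m≤j) = ∑-zero m (λ i → x i ℤ.* (x ^^ j) (m ∸ i)) term
  where
  term : ∀ i → i ≤ m → x i ℤ.* (x ^^ j) (m ∸ i) ≡ 0ℤ
  term zero    _   = cong (ℤ._* (x ^^ j) m) x₀≡0
  term (suc i) i<m = trans
    (cong (x (suc i) ℤ.*_)
      (^^-order x x₀≡0 j (ℕ.<-≤-trans (ℕ.∸-monoʳ-< {m} {suc i} {0} (s≤s z≤n) i<m) m≤j)))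
    (ℤ.*-zeroʳ (x (suc i)))

⊗-order : ∀ f g j → (∀ {m} → m < j → g m ≡ 0ℤ) → ∀ {m} → m < j → (f ⊗ g) m ≡ 0ℤ
⊗-order f g j g≡0 {m} m<j = ∑-zero m (λ i → f i ℤ.* g (m ∸ i)) λ i _ →
  trans (cong (f i ℤ.*_) (g≡0 (ℕ.≤-<-trans (ℕ.m∸n≤m m i) m<j))) (ℤ.*-zeroʳ (f i))

⊗-identityˡ : ∀ g → 𝟙 ⊗ g ≈ g
⊗-identityˡ g n = trans
  (cong₂ ℤ._+_ (ℤ.*-identityˡ (g n)) (sum-replicate-zero n))
  (ℤ.+-identityʳ (g n))

poch-step : ∀ a x → x 0 ≡ 0ℤ → ∀ {n N} → n < N → poch a x (suc N) n ≡ poch a x N n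
poch-step a x x₀≡0 {n} {N} n<N = trans
  (sum-cong-≗ λ i → cong (ℤ._* poch a x N (n ∸ toℕ i)) (factor (toℕ i) (ℕ.≤-pred (toℕ<n i))))
  (⊗-identityˡ (poch a x N) n)
  where
  factor : ∀ i → i ≤ n → (𝟙 ⊖ a ⊗ x ^^ N) i ≡ 𝟙 i
  factor i i≤n = trans
    (cong (ℤ._-_ (𝟙 i)) (⊗-order a (x ^^ N) N (^^-order x x₀≡0 N) (ℕ.≤-<-trans i≤n n<N)))
    (ℤ.+-identityʳ (𝟙 i))

poch∞-limit : ∀ a x → x 0 ≡ 0ℤ → ∀ {n N} → n < N → poch a x N n ≡ poch∞ a x n
poch∞-limit a x x₀≡0 {n} {suc N} (s≤s n≤N) with n ≟ N
... | yes refl = refl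
... | no  n≢N  = trans (poch-step a x x₀≡0 n<N) (poch∞-limit a x x₀≡0 n<N)
  where n<N = ℕ.≤∧≢⇒< n≤N n≢N

{-# OPTIONS --safe #-}
-- Write A_s = (q^s;q²)_∞ and F_k = ∑_{m≥1} q^{km} A_{m+1}, the generating
-- function of spt′. Since A_m = (1 - q^m) A_{m+2}, we have
-- q^m A_{m+2} = A_{m+2} - A_m. Applied to one factor q^{m-1} of q^{(k+1)m}
-- this gives F_{k+1} = q ∑_{m≥1} q^{km} (A_{m+1} - A_{m-1}), and as A_0 = 0,
-- reindexing the second sum yields F_{k+1} = (q - q^{2k+1}) F_k - q^{2k+1} A_1.
-- For k = 0 the sum telescopes to F_1 = q (2 - A_1).
module Submission where

open import Defs
open import Data.Nat.Base using (ℕ; _∸_; _≤_)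
open import Data.Integer.Base using (+_)

open import Data.Fin.Base using (toℕ)
open import Data.Integer.Base as ℤ using (ℤ; 0ℤ; 1ℤ; -1ℤ)
import Data.Integer.Properties as ℤ
open import Data.Integer.Tactic.RingSolver using (solve-∀)
open import Data.List.Base using (List; []; _∷_; _++_; length; filter; map; replicate)
import Data.List.Extrema.Nat as Extrema
open import Data.List.Membership.Propositional using (_∈_)
open import Data.List.Membership.Propositional.Properties using (∈-filter⁺; ∈-filter⁻; ∈-map⁺; ∈-map⁻; ∈-++⁺ˡ; ∈-++⁺ʳ; ∈-++⁻)
open import Data.List.Membership.Propositional.Properties.WithK using (unique∧set⇒bag)
open import Data.List.Properties using (++-cancelʳ; ++-identityʳ; filter-++; filter-all; filter-none; filter-accept; filter-reject; length-replicate; ∷-injectiveʳ)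
open import Data.List.Relation.Binary.BagAndSetEquality using (∼bag⇒↭)
open import Data.List.Relation.Binary.Permutation.Propositional as ↭ using (_↭_)
open import Data.List.Relation.Unary.All as All using (All; []; _∷_)
import Data.List.Relation.Unary.All.Properties as All
open import Data.List.Relation.Unary.AllPairs as AllPairs using (AllPairs; []; _∷_)
import Data.List.Relation.Unary.AllPairs.Properties as AllPairs
open import Data.List.Relation.Unary.Any using (here)
open import Data.List.Relation.Unary.Linked.Properties using (AllPairs⇒Linked; Linked⇒AllPairs)
open import Data.List.Relation.Unary.Unique.Propositional using (Unique)
import Data.List.Relation.Unary.Unique.Propositional.Properties as Unique
open import Data.Nat.Base using (zero; suc; parity; _+_; _*_; _<_; _≥_; _>_; z≤n; s≤s)
open import Data.Nat.ListAction using (sum)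
open import Data.Nat.ListAction.Properties using (sum-++)
open import Data.Nat.Properties as ℕ using (_≟_; _<?_)
import Data.Nat.Tactic.RingSolver as ℕRing
open import Data.Parity.Base using (0ℙ; 1ℙ)
import Data.Parity.Properties as ℙ
open import Data.Product.Base using (∃-syntax; _×_; _,_; proj₁; proj₂)
open import Data.Sum.Base using (inj₁; inj₂)
open import Function.Base using (_∘_)
open import Function.Bundles using (mk⇔)
open import Relation.Binary.PropositionalEquality
open import Relation.Nullary using (yes; no; contradiction)
open import Algebra.Properties.CommutativeMonoid.Sum ℤ.+-0-commutativeMonoid using (sum-cong-≗; ∑-distrib-+)
open ≡-Reasoning

-- A partition counted by `spt′ k` consists of k copies of its smallest part m and a set of distinct
-- parts among m + 1, m + 3, ...; giving each larger part the sign -1 turns the choice of that set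
-- into the product A_{m+1}. The recursion for F_k separates in two: the inhomogeneous term q^{2k+1}
-- A_1 is collected in T_k A_1, while the homogeneous factor q - q^{2k+1} = q (1 - q^{2k}) builds
-- q^k (q²;q²)_{k-1} up from the start value 2q. The obstacle is that F_0 does not exist: its terms
-- A_{m+1} tend to 1. All sums are therefore partial sums up to some M, and the identities are read
-- in degrees n ≤ M. The factors to be rearranged are monomials or differences of two monomials, so
-- multiplication by q^s is expressed by `shift`; identities between shifts then take the place of
-- associativity and commutativity of the Cauchy product.

-- Multiplication by monomials

shift : ℕ → PowerSeries → PowerSeries
shift zero    f n       = f n
shift (suc s) f zero    = 0ℤ
shift (suc s) f (suc n) = shift s f n

-- Coefficient n of a shift depends only on degrees up to n. Partial products and partial sums meet
-- their limits only in low degrees, so this is the congruence that applies to them.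
shift-cong-≤ : ∀ s {f g} n → (∀ i → i ≤ n → f i ≡ g i) → shift s f n ≡ shift s g n
shift-cong-≤ zero    n       f≡g = f≡g n ℕ.≤-refl
shift-cong-≤ (suc s) zero    f≡g = refl
shift-cong-≤ (suc s) (suc n) f≡g = shift-cong-≤ s n λ i i≤n → f≡g i (ℕ.m≤n⇒m≤1+n i≤n)

shift-cong : ∀ s {f g} → f ≈ g → shift s f ≈ shift s g
shift-cong s f≈g n = shift-cong-≤ s n λ i _ → f≈g i

shift-𝟘 : ∀ s → shift s 𝟘 ≈ 𝟘
shift-𝟘 zero    n       = refl
shift-𝟘 (suc s) zero    = refl
shift-𝟘 (suc s) (suc n) = shift-𝟘 s n

shift-⊕ : ∀ s f g → shift s (f ⊕ g) ≈ shift s f ⊕ shift s g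
shift-⊕ zero    f g n       = refl
shift-⊕ (suc s) f g zero    = refl
shift-⊕ (suc s) f g (suc n) = shift-⊕ s f g n

shift-⊖ : ∀ s f g → shift s (f ⊖ g) ≈ shift s f ⊖ shift s g
shift-⊖ zero    f g n       = refl
shift-⊖ (suc s) f g zero    = refl
shift-⊖ (suc s) f g (suc n) = shift-⊖ s f g n

shift-· : ∀ s c f → shift s (c · f) ≈ c · shift s f
shift-· zero    c f n       = refl
shift-· (suc s) c f zero    = sym (ℤ.*-zeroʳ c)
shift-· (suc s) c f (suc n) = shift-· s c f n

shift-+ : ∀ s t f → shift s (shift t f) ≈ shift (s + t) f
shift-+ zero    t f n       = refl
shift-+ (suc s) t f zero    = refl
shift-+ (suc s) t f (suc n) = shift-+ s t f n

shift-shift : ∀ s t u v f → s + t ≡ u + v → shift s (shift t f) ≈ shift u (shift v f)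
shift-shift s t u v f eq n =
  trans (shift-+ s t f n) (trans (cong (λ r → shift r f n) eq) (sym (shift-+ u v f n)))

shift-vanish : ∀ s f {n} → n < s → shift s f n ≡ 0ℤ
shift-vanish (suc s) f {zero}  n<s       = refl
shift-vanish (suc s) f {suc n} (s≤s n<s) = shift-vanish s f n<s

⊗-congʳ : ∀ {f g} h → f ≈ g → f ⊗ h ≈ g ⊗ h
⊗-congʳ h f≈g n = sum-cong-≗ {suc n} λ i → cong (ℤ._* h (n ∸ toℕ i)) (f≈g (toℕ i))

⊗-congˡ : ∀ f {g h} → g ≈ h → f ⊗ g ≈ f ⊗ h
⊗-congˡ f g≈h n = sum-cong-≗ {suc n} λ i → cong (f (toℕ i) ℤ.*_) (g≈h (n ∸ toℕ i))

⊗-distribʳ-⊕ : ∀ f g h → (f ⊕ g) ⊗ h ≈ f ⊗ h ⊕ g ⊗ h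
⊗-distribʳ-⊕ f g h n = trans
  (sum-cong-≗ {suc n} λ i → ℤ.*-distribʳ-+ (h (n ∸ toℕ i)) (f (toℕ i)) (g (toℕ i)))
  (∑-distrib-+ {suc n} (λ i → f (toℕ i) ℤ.* h (n ∸ toℕ i)) (λ i → g (toℕ i) ℤ.* h (n ∸ toℕ i)))

⊗-distribʳ-⊖ : ∀ f g h → (f ⊖ g) ⊗ h ≈ f ⊗ h ⊖ g ⊗ h
⊗-distribʳ-⊖ f g h n = begin
  ((f ⊖ g) ⊗ h) n                              ≡⟨ add-sub (((f ⊖ g) ⊗ h) n) ((g ⊗ h) n) ⟩
  (((f ⊖ g) ⊗ h) n ℤ.+ (g ⊗ h) n) ℤ.- (g ⊗ h) n ≡⟨ cong (ℤ._- (g ⊗ h) n) (⊗-distribʳ-⊕ (f ⊖ g) g h n) ⟨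
  ((f ⊖ g ⊕ g) ⊗ h) n ℤ.- (g ⊗ h) n
    ≡⟨ cong (ℤ._- (g ⊗ h) n) (⊗-congʳ h (λ i → sub-add (f i) (g i)) n) ⟩
  (f ⊗ h) n ℤ.- (g ⊗ h) n                      ∎
  where
  add-sub : ∀ x y → x ≡ (x ℤ.+ y) ℤ.- y
  add-sub = solve-∀
  sub-add : ∀ x y → (x ℤ.- y) ℤ.+ y ≡ x
  sub-add = solve-∀

shift-⊗ : ∀ s f g → shift s f ⊗ g ≈ shift s (f ⊗ g)
shift-⊗ zero    f g n       = refl
shift-⊗ (suc s) f g zero    = refl
-- The first term of the convolution is a multiple of 0; the others form, by computation, the
-- convolution one degree lower.
shift-⊗ (suc s) f g (suc n) = trans (ℤ.+-identityˡ ((shift s f ⊗ g) n)) (shift-⊗ s f g n)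

q≈shift : q ≈ shift 1 𝟙
q≈shift zero          = refl
q≈shift (suc zero)    = refl
q≈shift (suc (suc n)) = refl

monomial-⊗ : ∀ {a} s f → a ≈ shift s 𝟙 → a ⊗ f ≈ shift s f
monomial-⊗ {a} s f a≈ n = begin
  (a ⊗ f) n          ≡⟨ ⊗-congʳ f a≈ n ⟩
  (shift s 𝟙 ⊗ f) n  ≡⟨ shift-⊗ s 𝟙 f n ⟩
  shift s (𝟙 ⊗ f) n  ≡⟨ shift-cong s (⊗-identityˡ f) n ⟩
  shift s f n        ∎

monomial-^^ : ∀ {a} s → a ≈ shift s 𝟙 → ∀ j → a ^^ j ≈ shift (j * s) 𝟙
monomial-^^     s a≈ zero    n = refl
monomial-^^ {a} s a≈ (suc j) n = begin
  (a ⊗ a ^^ j) n            ≡⟨ monomial-⊗ s (a ^^ j) a≈ n ⟩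
  shift s (a ^^ j) n        ≡⟨ shift-cong s (monomial-^^ s a≈ j) n ⟩
  shift s (shift (j * s) 𝟙) n ≡⟨ shift-+ s (j * s) 𝟙 n ⟩
  shift (s + j * s) 𝟙 n     ∎

q^^≈shift : ∀ s → q ^^ s ≈ shift s 𝟙
q^^≈shift s n = trans (monomial-^^ 1 q≈shift s n) (cong (λ t → shift t 𝟙 n) (ℕ.*-identityʳ s))

-- The products (q^s;q²)_N and (q^s;q²)_∞

-- prod s N = (q^s;q²)_N and prod∞ s = (q^s;q²)_∞.
prod : ℕ → ℕ → PowerSeries
prod s zero    = 𝟙
prod s (suc N) = prod s N ⊖ shift (s + N * 2) (prod s N)

prod∞ : ℕ → PowerSeries
prod∞ s n = prod s (suc n) n

-- Each factor `𝟙 ⊖ a ⊗ x ^^ N` is 1 - q^(s+2N), so multiplying by it subtracts a shifted copy.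
poch≈prod : ∀ {a} s → a ≈ shift s 𝟙 → ∀ N → poch a (q ^^ 2) N ≈ prod s N
poch≈prod     s a≈ zero    n = refl
poch≈prod {a} s a≈ (suc N) n = begin
  ((𝟙 ⊖ a ⊗ x ^^ N) ⊗ p) n        ≡⟨ ⊗-distribʳ-⊖ 𝟙 (a ⊗ x ^^ N) p n ⟩
  (𝟙 ⊗ p) n ℤ.- (a ⊗ x ^^ N ⊗ p) n ≡⟨ cong₂ ℤ._-_ (⊗-identityˡ p n) (monomial-⊗ (s + N * 2) p ax≈ n) ⟩
  p n ℤ.- shift (s + N * 2) p n   ≡⟨ cong₂ ℤ._-_ (IH n) (shift-cong (s + N * 2) IH n) ⟩
  prod s (suc N) n ∎
  where
  x = q ^^ 2
  p = poch a x N
  IH = poch≈prod s a≈ N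
  ax≈ : a ⊗ x ^^ N ≈ shift (s + N * 2) 𝟙
  ax≈ i = begin
    (a ⊗ x ^^ N) i              ≡⟨ monomial-⊗ s (x ^^ N) a≈ i ⟩
    shift s (x ^^ N) i          ≡⟨ shift-cong s (monomial-^^ 2 (q^^≈shift 2) N) i ⟩
    shift s (shift (N * 2) 𝟙) i ≡⟨ shift-+ s (N * 2) 𝟙 i ⟩
    shift (s + N * 2) 𝟙 i ∎

minus-vanishing : ∀ x {y} → y ≡ 0ℤ → x ℤ.- y ≡ x
minus-vanishing x refl = ℤ.+-identityʳ x

prod-step : ∀ s {n N} → n < N → prod s (suc N) n ≡ prod s N n
prod-step s {n} {N} n<N = minus-vanishing (prod s N n) (shift-vanish (s + N * 2) (prod s N)
  (ℕ.<-≤-trans n<N (ℕ.≤-trans (ℕ.m≤m*n N 2) (ℕ.m≤n+m (N * 2) s))))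

prod-limit : ∀ s {n N} → n < N → prod s N n ≡ prod∞ s n
prod-limit s {n} {N} n<N = subst (λ M → prod s M n ≡ prod∞ s n) (ℕ.m∸n+n≡m n<N) (go (N ∸ suc n))
  where
  go : ∀ d → prod s (d + suc n) n ≡ prod∞ s n
  go zero    = refl
  go (suc d) = trans (prod-step s (ℕ.m≤n+m (suc n) d)) (go d)

-- Every factor is 1 - q^e with e ≥ s. In this form A_s tends to 1 at the end of the telescoping
-- sum.
prod-low : ∀ s N {n} → n < s → prod s N n ≡ 𝟙 n
prod-low s zero    n<s = refl
prod-low s (suc N) {n} n<s = trans
  (minus-vanishing (prod s N n) (shift-vanish (s + N * 2) (prod s N) (ℕ.<-≤-trans n<s (ℕ.m≤m+n s (N * 2)))))
  (prod-low s N n<s)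

-- `prod` recurses on its last factor; the first one, 1 - q^s, is reached by induction because
-- shifts commute. The last factors of both sides agree, as s + 2(N + 1) = (s + 2) + 2N.
prod-peel : ∀ s N → prod s (suc N) ≈ prod (2 + s) N ⊖ shift s (prod (2 + s) N)
prod-peel s zero    n = cong (λ t → 𝟙 n ℤ.- shift t 𝟙 n) (ℕ.+-identityʳ s)
prod-peel s (suc N) n = begin
  prod s (suc N) n ℤ.- shift u (prod s (suc N)) n
    ≡⟨ cong₂ ℤ._-_ (prod-peel s N n) (trans (shift-cong u (prod-peel s N) n) (shift-⊖ u p (shift s p) n)) ⟩
  (p n ℤ.- shift s p n) ℤ.- (shift u p n ℤ.- shift u (shift s p) n)
    ≡⟨ cong (λ z → (p n ℤ.- shift s p n) ℤ.- (shift u p n ℤ.- z)) (shift-shift u s s u p (ℕ.+-comm u s) n) ⟩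
  (p n ℤ.- shift s p n) ℤ.- (shift u p n ℤ.- shift s (shift u p) n)
    ≡⟨ rearrange (p n) (shift s p n) (shift u p n) (shift s (shift u p) n) ⟩
  (p n ℤ.- shift u p n) ℤ.- (shift s p n ℤ.- shift s (shift u p) n)
    ≡⟨ cong (ℤ._-_ (p n ℤ.- shift u p n)) (shift-⊖ s p (shift u p) n) ⟨
  (p n ℤ.- shift u p n) ℤ.- shift s (p ⊖ shift u p) n
    ≡⟨ cong (λ t → (p n ℤ.- shift t p n) ℤ.- shift s (p ⊖ shift t p) n) u≡ ⟩
  prod (2 + s) (suc N) n ℤ.- shift s (prod (2 + s) (suc N)) n ∎
  where
  u = s + suc N * 2
  p = prod (2 + s) N
  u≡ : s + suc N * 2 ≡ 2 + s + N * 2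
  u≡ = trans (ℕ.+-suc s _) (cong suc (ℕ.+-suc s _))
  rearrange : ∀ a b c d → (a ℤ.- b) ℤ.- (c ℤ.- d) ≡ (a ℤ.- c) ℤ.- (b ℤ.- d)
  rearrange = solve-∀

prod∞-peel : ∀ s → prod∞ s ≈ prod∞ (2 + s) ⊖ shift s (prod∞ (2 + s))
prod∞-peel s n = begin
  -- With `2 + n` factors, `suc n` remain after peeling, which is the truncation defining
  -- `prod∞ (2 + s) n`.
  prod∞ s n ≡⟨ prod-limit s (ℕ.m≤n⇒m≤1+n (ℕ.n<1+n n)) ⟨
  prod s (2 + n) n ≡⟨ prod-peel s (suc n) n ⟩
  prod∞ (2 + s) n ℤ.- shift s (prod (2 + s) (suc n)) n
    ≡⟨ cong (ℤ._-_ (prod∞ (2 + s) n)) (shift-cong-≤ s n λ i i≤n → prod-limit (2 + s) (s≤s i≤n)) ⟩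
  prod∞ (2 + s) n ℤ.- shift s (prod∞ (2 + s)) n ∎

-- The first factor is 1 - q^0.
prod∞-zero : prod∞ 0 ≈ 𝟘
prod∞-zero n = trans (prod∞-peel 0 n) (ℤ.+-inverseʳ (prod∞ 2 n))

-- Recurrence for the partial sums

-- upper k M = ∑_{m=1}^M q^{km} (q^{m+1};q²)_∞, the M-th partial sum of the
-- spt′ series, and lower k M = ∑_{m=1}^M q^{km} (q^{m-1};q²)_∞.
upper lower : ℕ → ℕ → PowerSeries
upper k zero    = 𝟘
upper k (suc m) = upper k m ⊕ shift (k * suc m) (prod∞ (2 + m))
lower k zero    = 𝟘
lower k (suc m) = lower k m ⊕ shift (k * suc m) (prod∞ m)

upper-suc : ∀ k M → upper (suc k) M ≈ shift 1 (upper k M ⊖ lower k M)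
upper-suc k zero    n = sym (shift-𝟘 1 n)
upper-suc k (suc m) n = begin
  upper (suc k) m n ℤ.+ shift (suc k * suc m) a n
    ≡⟨ cong₂ ℤ._+_ (trans (upper-suc k m n) (shift-⊖ 1 (upper k m) (lower k m) n)) term ⟩
  (shift 1 (upper k m) n ℤ.- shift 1 (lower k m) n) ℤ.+ (shift 1 (shift e a) n ℤ.- shift 1 (shift e b) n)
    ≡⟨ rearrange (shift 1 (upper k m) n) (shift 1 (lower k m) n) (shift 1 (shift e a) n) (shift 1 (shift e b) n) ⟩
  (shift 1 (upper k m) n ℤ.+ shift 1 (shift e a) n) ℤ.- (shift 1 (lower k m) n ℤ.+ shift 1 (shift e b) n)
    ≡⟨ cong₂ ℤ._-_ (shift-⊕ 1 (upper k m) (shift e a) n) (shift-⊕ 1 (lower k m) (shift e b) n) ⟨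
  shift 1 (upper k (suc m)) n ℤ.- shift 1 (lower k (suc m)) n
    ≡⟨ shift-⊖ 1 (upper k (suc m)) (lower k (suc m)) n ⟨
  shift 1 (upper k (suc m) ⊖ lower k (suc m)) n ∎
  where
  a = prod∞ (2 + m)
  b = prod∞ m
  e = k * suc m
  rearrange : ∀ x y z w → (x ℤ.- y) ℤ.+ (z ℤ.- w) ≡ (x ℤ.+ z) ℤ.- (y ℤ.+ w)
  rearrange = solve-∀
  sub-sub : ∀ x y → y ≡ x ℤ.- (x ℤ.- y)
  sub-sub = solve-∀
  peel : shift m a ≈ a ⊖ b
  peel i = trans (sub-sub (a i) (shift m a i)) (cong (ℤ._-_ (a i)) (sym (prod∞-peel m i)))
  -- The exponent splits as 1 + e + m: `shift m` is spent on `peel`, and `shift 1` becomes the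
  -- factor q in front.
  term : shift (suc k * suc m) a n ≡ shift 1 (shift e a) n ℤ.- shift 1 (shift e b) n
  term = begin
    shift (suc (m + e)) a n       ≡⟨ cong (λ t → shift (suc t) a n) (ℕ.+-comm m e) ⟩
    shift (suc (e + m)) a n       ≡⟨ shift-+ (suc e) m a n ⟨
    shift (suc e) (shift m a) n   ≡⟨ shift-cong (suc e) peel n ⟩
    shift (suc e) (a ⊖ b) n       ≡⟨ shift-⊖ (suc e) a b n ⟩
    shift (suc e) a n ℤ.- shift (suc e) b n
      ≡⟨ cong₂ ℤ._-_ (shift-+ 1 e a n) (shift-+ 1 e b n) ⟨
    shift 1 (shift e a) n ℤ.- shift 1 (shift e b) n ∎

-- The term with A_0 vanishes, the next one is q^(2k) A_1, and every later term is q^(2k) times the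
-- term of `upper` two indices earlier.
lower-suc-suc : ∀ k M → lower k (2 + M) ≈ shift (k * 2) (prod∞ 1 ⊕ upper k M)
lower-suc-suc k zero n = begin
  (0ℤ ℤ.+ shift (k * 1) (prod∞ 0) n) ℤ.+ shift (k * 2) (prod∞ 1) n
    ≡⟨ cong (λ z → (0ℤ ℤ.+ z) ℤ.+ shift (k * 2) (prod∞ 1) n)
         (trans (shift-cong (k * 1) prod∞-zero n) (shift-𝟘 (k * 1) n)) ⟩
  0ℤ ℤ.+ shift (k * 2) (prod∞ 1) n
    ≡⟨ ℤ.+-identityˡ _ ⟩
  shift (k * 2) (prod∞ 1) n
    ≡⟨ shift-cong (k * 2) (λ i → ℤ.+-identityʳ (prod∞ 1 i)) n ⟨
  shift (k * 2) (prod∞ 1 ⊕ 𝟘) n ∎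
lower-suc-suc k (suc m) n = begin
  lower k (2 + m) n ℤ.+ shift (k * (3 + m)) a n
    ≡⟨ cong₂ ℤ._+_ (lower-suc-suc k m n) (cong (λ t → shift t a n) (exponent k m)) ⟩
  shift (k * 2) (prod∞ 1 ⊕ upper k m) n ℤ.+ shift (k * 2 + k * suc m) a n
    ≡⟨ cong (ℤ._+_ (shift (k * 2) (prod∞ 1 ⊕ upper k m) n)) (shift-+ (k * 2) (k * suc m) a n) ⟨
  shift (k * 2) (prod∞ 1 ⊕ upper k m) n ℤ.+ shift (k * 2) (shift (k * suc m) a) n
    ≡⟨ shift-⊕ (k * 2) (prod∞ 1 ⊕ upper k m) (shift (k * suc m) a) n ⟨
  shift (k * 2) (prod∞ 1 ⊕ upper k m ⊕ shift (k * suc m) a) n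
    ≡⟨ shift-cong (k * 2) (λ i → ℤ.+-assoc (prod∞ 1 i) (upper k m i) (shift (k * suc m) a i)) n ⟩
  shift (k * 2) (prod∞ 1 ⊕ upper k (suc m)) n ∎
  where
  a = prod∞ (2 + m)
  exponent : ∀ k m → k * (3 + m) ≡ k * 2 + k * suc m
  exponent k m = ℕ.*-distribˡ-+ k 2 (suc m)

-- The term with index `suc M` starts in degree at least `suc M` because the exponent `suc k` is
-- positive. At exponent 0 the partial sums never settle.
upper-step : ∀ k {n M} → n ≤ M → upper (suc k) (suc M) n ≡ upper (suc k) M n
upper-step k {n} {M} n≤M = trans
  (cong (ℤ._+_ (upper (suc k) M n)) (shift-vanish (suc k * suc M) (prod∞ (2 + M))
    (ℕ.<-≤-trans (s≤s n≤M) (ℕ.m≤m+n (suc M) (k * suc M)))))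
  (ℤ.+-identityʳ _)

-- Two further terms on the left let `lower-suc-suc` apply. `upper k (2 + M)` and `upper k M` are
-- kept apart because for k = 0 their difference contributes.
upper-suc-rec : ∀ k {n M} → n ≤ M →
  upper (suc k) M n ≡ shift 1 (upper k (2 + M) ⊖ shift (k * 2) (prod∞ 1 ⊕ upper k M)) n
upper-suc-rec k {n} {M} n≤M = begin
  upper (suc k) M n       ≡⟨ upper-step k n≤M ⟨
  upper (suc k) (1 + M) n ≡⟨ upper-step k (ℕ.m≤n⇒m≤1+n n≤M) ⟨
  upper (suc k) (2 + M) n ≡⟨ upper-suc k (2 + M) n ⟩
  shift 1 (upper k (2 + M) ⊖ lower k (2 + M)) n
    ≡⟨ shift-cong 1 (λ i → cong (ℤ._-_ (upper k (2 + M) i)) (lower-suc-suc k M i)) n ⟩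
  shift 1 (upper k (2 + M) ⊖ shift (k * 2) (prod∞ 1 ⊕ upper k M)) n ∎

-- Solving the recurrence

closed : ℕ → PowerSeries
closed k = T (suc k) ⊗ prod∞ 1 ⊕ (+ 2) · shift (suc k) (prod 2 k)

-- The recursion for `T` multiplies by monomials only, so it is turned into shifts before the
-- product with `f` is expanded by `shift-⊗`.
T-suc : ∀ k f → T (2 + k) ⊗ f ≈
  shift 1 (T (suc k) ⊗ f) ⊖ shift (1 + suc k * 2) (T (suc k) ⊗ f) ⊖ shift (1 + suc k * 2) f
T-suc k f n = begin
  (((q ⊖ Q) ⊗ t ⊖ Q) ⊗ f) n
    ≡⟨ ⊗-distribʳ-⊖ ((q ⊖ Q) ⊗ t) Q f n ⟩
  ((q ⊖ Q) ⊗ t ⊗ f) n ℤ.- (Q ⊗ f) n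
    ≡⟨ cong₂ ℤ._-_ (⊗-congʳ f factor n) (monomial-⊗ e f Q≈ n) ⟩
  ((shift 1 t ⊖ shift e t) ⊗ f) n ℤ.- shift e f n
    ≡⟨ cong (ℤ._- shift e f n) (⊗-distribʳ-⊖ (shift 1 t) (shift e t) f n) ⟩
  ((shift 1 t ⊗ f) n ℤ.- (shift e t ⊗ f) n) ℤ.- shift e f n
    ≡⟨ cong (ℤ._- shift e f n) (cong₂ ℤ._-_ (shift-⊗ 1 t f n) (shift-⊗ e t f n)) ⟩
  (shift 1 (t ⊗ f) n ℤ.- shift e (t ⊗ f) n) ℤ.- shift e f n ∎
  where
  t = T (suc k)
  e = 1 + suc k * 2
  Q = q ^^ (2 * (2 + k) ∸ 1)
  -- The left side is what `2 * (2 + k) ∸ 1` computes to, free of truncated subtraction.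
  exponent : ∀ k → suc k + suc (suc k + 0) ≡ 1 + suc k * 2
  exponent = ℕRing.solve-∀
  Q≈ : Q ≈ shift e 𝟙
  Q≈ i = trans (q^^≈shift (2 * (2 + k) ∸ 1) i) (cong (λ s → shift s 𝟙 i) (exponent k))
  factor : (q ⊖ Q) ⊗ t ≈ shift 1 t ⊖ shift e t
  factor i = trans (⊗-distribʳ-⊖ q Q t i) (cong₂ ℤ._-_ (monomial-⊗ 1 t q≈shift i) (monomial-⊗ e t Q≈ i))

T-one : ∀ f → T 1 ⊗ f ≈ ⊝ shift 1 f
T-one f n = begin
  (⊝ q ⊗ f) n               ≡⟨ ⊗-congʳ f (λ i → sym (ℤ.+-identityˡ (ℤ.- q i))) n ⟩
  ((𝟘 ⊖ q) ⊗ f) n           ≡⟨ ⊗-distribʳ-⊖ 𝟘 q f n ⟩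
  (𝟘 ⊗ f) n ℤ.- (q ⊗ f) n
    ≡⟨ cong₂ ℤ._-_ (∑-zero n (λ i → 0ℤ ℤ.* f (n ∸ i)) λ _ _ → refl) (monomial-⊗ 1 f q≈shift n) ⟩
  0ℤ ℤ.- shift 1 f n        ≡⟨ ℤ.+-identityˡ _ ⟩
  ℤ.- shift 1 f n           ∎

-- Induction on k with M left general: the step uses the hypothesis at `2 + M` and at `M`.
upper≡closed : ∀ k {n M} → n ≤ M → upper (suc k) M n ≡ closed k n
upper≡closed zero {n} {M} n≤M = begin
  upper 1 M n
    ≡⟨ upper-suc-rec 0 n≤M ⟩
  shift 1 (upper 0 (2 + M) ⊖ (prod∞ 1 ⊕ upper 0 M)) n
    ≡⟨ shift-cong-≤ 1 n telescope ⟩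
  shift 1 ((+ 2) · 𝟙 ⊖ prod∞ 1) n
    ≡⟨ shift-⊖ 1 ((+ 2) · 𝟙) (prod∞ 1) n ⟩
  shift 1 ((+ 2) · 𝟙) n ℤ.- shift 1 (prod∞ 1) n
    ≡⟨ cong (ℤ._- shift 1 (prod∞ 1) n) (shift-· 1 (+ 2) 𝟙 n) ⟩
  (+ 2) ℤ.* shift 1 𝟙 n ℤ.- shift 1 (prod∞ 1) n
    ≡⟨ ℤ.+-comm ((+ 2) ℤ.* shift 1 𝟙 n) (ℤ.- shift 1 (prod∞ 1) n) ⟩
  ℤ.- shift 1 (prod∞ 1) n ℤ.+ (+ 2) ℤ.* shift 1 𝟙 n
    ≡⟨ cong (ℤ._+ (+ 2) ℤ.* shift 1 𝟙 n) (T-one (prod∞ 1) n) ⟨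
  closed 0 n ∎
  where
  cancel : ∀ u x a → ((u ℤ.+ x) ℤ.+ x) ℤ.- (a ℤ.+ u) ≡ (+ 2) ℤ.* x ℤ.- a
  cancel = solve-∀
  -- The two partial sums differ by A_{M+2} + A_{M+3}, and both series agree with 1 in degrees i ≤
  -- M. This is the origin of the constant 2.
  telescope : ∀ i → i ≤ n → (upper 0 (2 + M) ⊖ (prod∞ 1 ⊕ upper 0 M)) i ≡ ((+ 2) · 𝟙 ⊖ prod∞ 1) i
  telescope i i≤n = begin
    ((upper 0 M i ℤ.+ prod∞ (2 + M) i) ℤ.+ prod∞ (3 + M) i) ℤ.- (prod∞ 1 i ℤ.+ upper 0 M i)
      ≡⟨ cong₂ (λ x y → ((upper 0 M i ℤ.+ x) ℤ.+ y) ℤ.- (prod∞ 1 i ℤ.+ upper 0 M i))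
           (prod-low (2 + M) (suc i) (ℕ.m≤n⇒m≤1+n i<1+M))
           (prod-low (3 + M) (suc i) (ℕ.m≤n⇒m≤1+n (ℕ.m≤n⇒m≤1+n i<1+M))) ⟩
    ((upper 0 M i ℤ.+ 𝟙 i) ℤ.+ 𝟙 i) ℤ.- (prod∞ 1 i ℤ.+ upper 0 M i)
      ≡⟨ cancel (upper 0 M i) (𝟙 i) (prod∞ 1 i) ⟩
    (+ 2) ℤ.* 𝟙 i ℤ.- prod∞ 1 i ∎
    where
    i<1+M : i < suc M
    i<1+M = s≤s (ℕ.≤-trans i≤n n≤M)
upper≡closed (suc k) {n} {M} n≤M = begin
  upper (2 + k) M n
    ≡⟨ upper-suc-rec (suc k) n≤M ⟩
  shift 1 (upper (suc k) (2 + M) ⊖ shift e (prod∞ 1 ⊕ upper (suc k) M)) n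
    ≡⟨ shift-cong-≤ 1 n (λ i i≤n → cong₂ ℤ._-_
         (upper≡closed k (ℕ.≤-trans i≤n (ℕ.≤-trans n≤M (ℕ.m≤n+m M 2))))
         (shift-cong-≤ e i λ j j≤i → cong (ℤ._+_ (prod∞ 1 j))
           (upper≡closed k (ℕ.≤-trans j≤i (ℕ.≤-trans i≤n n≤M))))) ⟩
  shift 1 (closed k ⊖ shift e (prod∞ 1 ⊕ closed k)) n
    ≡⟨ trans (shift-⊖ 1 (closed k) (shift e (prod∞ 1 ⊕ closed k)) n)
         (cong (ℤ._-_ (shift 1 (closed k) n)) (shift-+ 1 e (prod∞ 1 ⊕ closed k) n)) ⟩
  shift 1 (closed k) n ℤ.- shift e′ (prod∞ 1 ⊕ closed k) n
    ≡⟨ cong₂ ℤ._-_ (split 1) (trans (shift-⊕ e′ (prod∞ 1) (closed k) n) (cong (ℤ._+_ (shift e′ (prod∞ 1) n)) (split e′))) ⟩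
  (shift 1 t n ℤ.+ (+ 2) ℤ.* shift 1 r n) ℤ.- (shift e′ (prod∞ 1) n ℤ.+ (shift e′ t n ℤ.+ (+ 2) ℤ.* shift e′ r n))
    ≡⟨ rearrange (shift 1 t n) (shift 1 r n) (shift e′ (prod∞ 1) n) (shift e′ t n) (shift e′ r n) ⟩
  ((shift 1 t n ℤ.- shift e′ t n) ℤ.- shift e′ (prod∞ 1) n) ℤ.+ (+ 2) ℤ.* (shift 1 r n ℤ.- shift e′ r n)
    ≡⟨ cong₂ (λ x y → x ℤ.+ (+ 2) ℤ.* y) (T-suc k (prod∞ 1) n) remainder ⟨
  closed (suc k) n ∎
  where
  e e′ : ℕ
  e  = suc k * 2
  e′ = 1 + e
  t r : PowerSeries
  t = T (suc k) ⊗ prod∞ 1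
  r = shift (suc k) (prod 2 k)
  split : ∀ s → shift s (closed k) n ≡ shift s t n ℤ.+ (+ 2) ℤ.* shift s r n
  split s = trans (shift-⊕ s t ((+ 2) · r) n) (cong (ℤ._+_ (shift s t n)) (shift-· s (+ 2) r n))
  -- The factor q - q^(2k+3) = q (1 - q^(2(k+1))) raises the power of q by one and appends the next
  -- factor of (q²;q²)_k.
  remainder : shift (2 + k) (prod 2 (suc k)) n ≡ shift 1 r n ℤ.- shift e′ r n
  remainder = trans (shift-⊖ (2 + k) (prod 2 k) (shift e (prod 2 k)) n) (cong₂ ℤ._-_
    (sym (shift-+ 1 (suc k) (prod 2 k) n))
    (shift-shift (2 + k) e e′ (suc k) (prod 2 k) (trans (ℕ.+-comm (2 + k) e) (ℕ.+-suc e (suc k))) n))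
  rearrange : ∀ x y a z w → (x ℤ.+ (+ 2) ℤ.* y) ℤ.- (a ℤ.+ (z ℤ.+ (+ 2) ℤ.* w))
                          ≡ ((x ℤ.- z) ℤ.- a) ℤ.+ (+ 2) ℤ.* (y ℤ.- w)
  rearrange = solve-∀

closed≈ : ∀ k → closed k ≈ T (suc k) ⊗ poch∞ q (q ^^ 2) ⊕ (+ 2) · (q ^^ suc k ⊗ poch (q ^^ 2) (q ^^ 2) k)
closed≈ k n = sym (cong₂ (λ x y → x ℤ.+ (+ 2) ℤ.* y)
  -- In degree i, `poch∞` and `prod∞` both stop after `suc i` factors, so the finite comparison
  -- suffices.
  (⊗-congˡ (T (suc k)) (λ i → poch≈prod 1 q≈shift (suc i) i) n)
  (trans (monomial-⊗ (suc k) (poch (q ^^ 2) (q ^^ 2) k) (q^^≈shift (suc k)) n)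
         (shift-cong (suc k) (poch≈prod 2 (q^^≈shift 2) k) n)))

-- Signed counts and generating functions

sign : ℕ → ℤ
sign zero    = 1ℤ
sign (suc n) = ℤ.- sign n

sign-parity : ∀ n → (parity n ≡ 0ℙ → sign n ≡ 1ℤ) × (parity n ≡ 1ℙ → sign n ≡ -1ℤ)
sign-parity zero          = (λ _ → refl) , λ ()
sign-parity (suc zero)    = (λ ()) , λ _ → refl
sign-parity (suc (suc n)) =
  (λ e → trans (ℤ.neg-involutive (sign n)) (proj₁ (sign-parity n) e)) ,
  (λ e → trans (ℤ.neg-involutive (sign n)) (proj₂ (sign-parity n) e))

total : (List ℕ → ℤ) → List (List ℕ) → ℤ
total w []      = 0ℤ
total w (π ∷ L) = w π ℤ.+ total w L

total-↭ : ∀ w {L L′} → L ↭ L′ → total w L ≡ total w L′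
total-↭ w ↭.refl                 = refl
total-↭ w (↭.prep π p)           = cong (ℤ._+_ (w π)) (total-↭ w p)
total-↭ w (↭.swap {xs} {ys} π ρ p) = trans
  (cong (λ t → w π ℤ.+ (w ρ ℤ.+ t)) (total-↭ w p))
  (exchange (w π) (w ρ) (total w ys))
  where
  exchange : ∀ a b c → a ℤ.+ (b ℤ.+ c) ≡ b ℤ.+ (a ℤ.+ c)
  exchange = solve-∀
total-↭ w (↭.trans p p′)         = trans (total-↭ w p) (total-↭ w p′)

-- Replaces a difference of two counts by one signed sum, which permutations of the list preserve.
even-odd-difference : ∀ (h : List ℕ → ℕ) L →
  + length (filter (λ π → parity (h π) ℙ.≟ 0ℙ) L) ℤ.- + length (filter (λ π → parity (h π) ℙ.≟ 1ℙ) L)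
  ≡ total (sign ∘ h) L
even-odd-difference h []      = refl
even-odd-difference h (π ∷ L) with parity (h π) in eq
... | 0ℙ = begin
  (1ℤ ℤ.+ a) ℤ.- b         ≡⟨ ℤ.+-assoc 1ℤ a (ℤ.- b) ⟩
  1ℤ ℤ.+ (a ℤ.- b)
    ≡⟨ cong₂ ℤ._+_ (sym (proj₁ (sign-parity (h π)) eq)) (even-odd-difference h L) ⟩
  total (sign ∘ h) (π ∷ L) ∎
  where
  a = + length (filter (λ π → parity (h π) ℙ.≟ 0ℙ) L)
  b = + length (filter (λ π → parity (h π) ℙ.≟ 1ℙ) L)
... | 1ℙ = begin
  a ℤ.- (1ℤ ℤ.+ b)         ≡⟨ rearrange a b ⟩
  -1ℤ ℤ.+ (a ℤ.- b)
    ≡⟨ cong₂ ℤ._+_ (sym (proj₂ (sign-parity (h π)) eq)) (even-odd-difference h L) ⟩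
  total (sign ∘ h) (π ∷ L) ∎
  where
  a = + length (filter (λ π → parity (h π) ℙ.≟ 0ℙ) L)
  b = + length (filter (λ π → parity (h π) ℙ.≟ 1ℙ) L)
  rearrange : ∀ a b → a ℤ.- (1ℤ ℤ.+ b) ≡ -1ℤ ℤ.+ (a ℤ.- b)
  rearrange = solve-∀

-- genfun w L = ∑_{π ∈ L} w(π) q^{|π|}
genfun : (List ℕ → ℤ) → List (List ℕ) → PowerSeries
genfun w []      = 𝟘
genfun w (π ∷ L) = w π · shift (sum π) 𝟙 ⊕ genfun w L

genfun-++ : ∀ w L L′ → genfun w (L ++ L′) ≈ genfun w L ⊕ genfun w L′
genfun-++ w []      L′ n = sym (ℤ.+-identityˡ (genfun w L′ n))
genfun-++ w (π ∷ L) L′ n = trans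
  (cong (ℤ._+_ ((w π · shift (sum π) 𝟙) n)) (genfun-++ w L L′ n))
  (sym (ℤ.+-assoc ((w π · shift (sum π) 𝟙) n) (genfun w L n) (genfun w L′ n)))

-- Serves with σ = -1 for adding a larger part and with σ = 1 for appending the copies of the
-- smallest part. The conditions range over members of `L` only, since the sign of a candidate is
-- known only for those.
genfun-map : ∀ c σ g w w′ {L} → All (λ π → sum (g π) ≡ c + sum π × w (g π) ≡ σ ℤ.* w′ π) L →
  genfun w (map g L) ≈ σ · shift c (genfun w′ L)
genfun-map c σ g w w′ {[]} [] n =
  sym (trans (cong (ℤ._*_ σ) (shift-𝟘 c n)) (ℤ.*-zeroʳ σ))
genfun-map c σ g w w′ {π ∷ L} ((sum≡ , w≡) ∷ rest) n = begin
  w (g π) ℤ.* shift (sum (g π)) 𝟙 n ℤ.+ genfun w (map g L) n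
    ≡⟨ cong₂ ℤ._+_ (cong₂ (λ x s → x ℤ.* shift s 𝟙 n) w≡ sum≡) (genfun-map c σ g w w′ rest n) ⟩
  (σ ℤ.* w′ π) ℤ.* shift (c + sum π) 𝟙 n ℤ.+ σ ℤ.* shift c (genfun w′ L) n
    ≡⟨ cong (λ z → (σ ℤ.* w′ π) ℤ.* z ℤ.+ σ ℤ.* shift c (genfun w′ L) n) (shift-+ c (sum π) 𝟙 n) ⟨
  (σ ℤ.* w′ π) ℤ.* shift c (shift (sum π) 𝟙) n ℤ.+ σ ℤ.* shift c (genfun w′ L) n
    ≡⟨ factor σ (w′ π) (shift c (shift (sum π) 𝟙) n) (shift c (genfun w′ L) n) ⟩
  σ ℤ.* (w′ π ℤ.* shift c (shift (sum π) 𝟙) n ℤ.+ shift c (genfun w′ L) n)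
    ≡⟨ cong (λ z → σ ℤ.* (z ℤ.+ shift c (genfun w′ L) n)) (shift-· c (w′ π) (shift (sum π) 𝟙) n) ⟨
  σ ℤ.* (shift c (w′ π · shift (sum π) 𝟙) n ℤ.+ shift c (genfun w′ L) n)
    ≡⟨ cong (ℤ._*_ σ) (shift-⊕ c (w′ π · shift (sum π) 𝟙) (genfun w′ L) n) ⟨
  σ ℤ.* shift c (genfun w′ (π ∷ L)) n ∎
  where
  factor : ∀ s x y z → (s ℤ.* x) ℤ.* y ℤ.+ s ℤ.* z ≡ s ℤ.* (x ℤ.* y ℤ.+ z)
  factor = solve-∀

shift-𝟙-diag : ∀ s → shift s 𝟙 s ≡ 1ℤ
shift-𝟙-diag zero    = refl
shift-𝟙-diag (suc s) = shift-𝟙-diag s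

shift-𝟙-off : ∀ {s n} → s ≢ n → shift s 𝟙 n ≡ 0ℤ
shift-𝟙-off {zero}  {zero}  s≢n = contradiction refl s≢n
shift-𝟙-off {zero}  {suc n} s≢n = refl
shift-𝟙-off {suc s} {zero}  s≢n = refl
shift-𝟙-off {suc s} {suc n} s≢n = shift-𝟙-off (s≢n ∘ cong suc)

total-filter-sum : ∀ w L n → total w (filter (λ π → sum π ≟ n) L) ≡ genfun w L n
total-filter-sum w []      n = refl
total-filter-sum w (π ∷ L) n with sum π ≟ n
... | yes refl = begin
  total w (filter P? (π ∷ L))           ≡⟨ cong (total w) (filter-accept P? {π} {L} refl) ⟩
  w π ℤ.+ total w (filter P? L)
    ≡⟨ cong₂ ℤ._+_ (sym (trans (cong (ℤ._*_ (w π)) (shift-𝟙-diag n)) (ℤ.*-identityʳ (w π)))) (total-filter-sum w L n) ⟩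
  genfun w (π ∷ L) n                    ∎
  where P? = λ π′ → sum π′ ≟ n
... | no s≢n = begin
  total w (filter P? (π ∷ L))           ≡⟨ cong (total w) (filter-reject P? {π} {L} s≢n) ⟩
  total w (filter P? L)                 ≡⟨ total-filter-sum w L n ⟩
  genfun w L n                          ≡⟨ ℤ.+-identityˡ (genfun w L n) ⟨
  0ℤ ℤ.+ genfun w L n
    ≡⟨ cong (ℤ._+ genfun w L n) (trans (cong (ℤ._*_ (w π)) (shift-𝟙-off s≢n)) (ℤ.*-zeroʳ (w π))) ⟨
  genfun w (π ∷ L) n                    ∎
  where P? = λ π′ → sum π′ ≟ n

-- Sets of larger parts

-- The strictly decreasing lists with parts among s, s + 2, …, s + 2(N - 1).
chains : ℕ → ℕ → List (List ℕ)
chains s zero    = [] ∷ []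
chains s (suc N) = chains s N ++ map (s + N * 2 ∷_) (chains s N)

-- `chains` branches on its largest admissible part as `prod` does on its last factor: omitting the
-- part gives 1, taking it gives -q^(s+2N).
genfun-chains : ∀ s N → genfun (sign ∘ length) (chains s N) ≈ prod s N
genfun-chains s zero n = trans (ℤ.+-identityʳ _) (ℤ.*-identityˡ (𝟙 n))
genfun-chains s (suc N) n = begin
  genfun w (C ++ map (p ∷_) C) n                  ≡⟨ genfun-++ w C (map (p ∷_) C) n ⟩
  genfun w C n ℤ.+ genfun w (map (p ∷_) C) n
    ≡⟨ cong (ℤ._+_ (genfun w C n)) (genfun-map p -1ℤ (p ∷_) w w signs n) ⟩
  genfun w C n ℤ.+ -1ℤ ℤ.* shift p (genfun w C) n
    ≡⟨ cong₂ (λ x y → x ℤ.+ -1ℤ ℤ.* y) (genfun-chains s N n) (shift-cong p (genfun-chains s N) n) ⟩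
  prod s N n ℤ.+ -1ℤ ℤ.* shift p (prod s N) n
    ≡⟨ cong (ℤ._+_ (prod s N n)) (ℤ.-1*i≡-i (shift p (prod s N) n)) ⟩
  prod s (suc N) n                                ∎
  where
  w = sign ∘ length
  C = chains s N
  p = s + N * 2
  signs : All (λ π → sum (p ∷ π) ≡ p + sum π × w (p ∷ π) ≡ -1ℤ ℤ.* w π) C
  signs = All.tabulate λ {π} _ → refl , sym (ℤ.-1*i≡-i (w π))

Step : ℕ → ℕ → ℕ → Set
Step s N p = ∃[ j ] j < N × p ≡ s + j * 2

step-< : ∀ s {j N} → j < N → s + j * 2 < s + N * 2
step-< s j<N = ℕ.+-monoʳ-< s (ℕ.*-monoˡ-< 2 j<N)

step-below : ∀ {s N M p} → p < s + N * 2 → Step s M p → Step s N p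
step-below {s} {N} p<  (j , _ , refl) = j , ℕ.*-cancelʳ-< 2 j N (ℕ.+-cancelˡ-< s (j * 2) (N * 2) p<) , refl

step-weaken : ∀ {s N p} → Step s N p → Step s (suc N) p
step-weaken (j , j<N , eq) = j , ℕ.m≤n⇒m≤1+n j<N , eq

chains-sound : ∀ s N {π} → π ∈ chains s N → AllPairs _>_ π × All (Step s N) π
chains-sound s zero    (here refl) = [] , []
chains-sound s (suc N) π∈ with ∈-++⁻ (chains s N) π∈
... | inj₁ π∈ˡ with chains-sound s N π∈ˡ
...   | dec , steps = dec , All.map step-weaken steps
chains-sound s (suc N) π∈ | inj₂ π∈ʳ with ∈-map⁻ (s + N * 2 ∷_) π∈ʳ
...   | ρ , ρ∈ , refl with chains-sound s N ρ∈
...     | dec , steps =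
  All.map (λ { (j , j<N , refl) → step-< s j<N }) steps ∷ dec ,
  (N , ℕ.n<1+n N , refl) ∷ All.map step-weaken steps

-- In a strictly decreasing list the head bounds all other parts, so the head alone decides whether
-- `s + N * 2` occurs.
chains-complete : ∀ s N {π} → AllPairs _>_ π → All (Step s N) π → π ∈ chains s N
chains-complete s zero    {[]}    _ _ = here refl
chains-complete s zero    {p ∷ π} _ ((_ , () , _) ∷ _)
chains-complete s (suc N) {[]}    _ _ = ∈-++⁺ˡ (chains-complete s N [] [])
chains-complete s (suc N) {p ∷ π} (p> ∷ dec) ((j , j<1+N , refl) ∷ steps) with j ≟ N
... | yes refl = ∈-++⁺ʳ (chains s N) (∈-map⁺ (s + N * 2 ∷_)
  (chains-complete s N dec (All.zipWith (λ (p< , st) → step-below p< st) (p> , steps))))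
... | no j≢N = ∈-++⁺ˡ (chains-complete s N (p> ∷ dec) ((j , j<N , refl) ∷
    All.zipWith (λ (p< , st) → step-below (ℕ.<-trans p< (step-< s j<N)) st) (p> , steps)))
  where j<N = ℕ.≤∧≢⇒< (ℕ.≤-pred j<1+N) j≢N

chains-unique : ∀ s N → Unique (chains s N)
chains-unique s zero    = [] ∷ []
chains-unique s (suc N) = Unique.++⁺ (chains-unique s N)
  (Unique.map⁺ ∷-injectiveʳ (chains-unique s N)) disjoint
  where
  disjoint : ∀ {π} → π ∈ chains s N × π ∈ map (s + N * 2 ∷_) (chains s N) → _
  disjoint (π∈ , π∈′) with ∈-map⁻ (s + N * 2 ∷_) π∈′
  ... | _ , _ , refl with chains-sound s N π∈
  ...   | _ , (j , j<N , eq) ∷ _ = ℕ.<-irrefl (sym eq) (step-< s j<N)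

-- Larger parts followed by copies of the smallest part

module _ {m π} (k : ℕ) (m<π : All (m <_) π) where

  private
    tail = replicate (suc k) m

  smallest-++-replicate : smallest (π ++ tail) ≡ m
  smallest-++-replicate = smallest≡ (π ++ tail) (∈-++⁺ʳ π (here refl))
    (All.++⁺ (All.map ℕ.<⇒≤ m<π) (All.replicate⁺ (suc k) ℕ.≤-refl))
    where
    smallest≡ : ∀ ρ → m ∈ ρ → All (m ≤_) ρ → smallest ρ ≡ m
    smallest≡ (p ∷ ρ) m∈ (m≤p ∷ m≤ρ) = ℕ.≤-antisym
      (All.lookup (Extrema.min≤⊤ p ρ ∷ Extrema.min≤xs p ρ) m∈)
      (Extrema.v≤min⁺ m≤p m≤ρ)

  largerParts-++-replicate : largerParts (π ++ tail) ≡ π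
  largerParts-++-replicate = begin
    filter (smallest (π ++ tail) <?_) (π ++ tail)
      ≡⟨ cong (λ x → filter (x <?_) (π ++ tail)) smallest-++-replicate ⟩
    filter (m <?_) (π ++ tail)               ≡⟨ filter-++ (m <?_) π tail ⟩
    filter (m <?_) π ++ filter (m <?_) tail
      ≡⟨ cong₂ _++_ (filter-all (m <?_) m<π) (filter-none (m <?_) (All.replicate⁺ (suc k) (ℕ.<-irrefl refl))) ⟩
    π ++ []                                  ≡⟨ ++-identityʳ π ⟩
    π ∎

  multiplicity-++-replicate : multiplicity (smallest (π ++ tail)) (π ++ tail) ≡ suc k
  multiplicity-++-replicate = begin
    length (filter (smallest (π ++ tail) ≟_) (π ++ tail))
      ≡⟨ cong (λ x → length (filter (x ≟_) (π ++ tail))) smallest-++-replicate ⟩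
    length (filter (m ≟_) (π ++ tail))       ≡⟨ cong length (filter-++ (m ≟_) π tail) ⟩
    length (filter (m ≟_) π ++ filter (m ≟_) tail)
      ≡⟨ cong length (cong₂ _++_ (filter-none (m ≟_) (All.map ℕ.<⇒≢ m<π))
           (filter-all (m ≟_) {xs = tail} (All.replicate⁺ (suc k) refl))) ⟩
    length tail                              ≡⟨ length-replicate (suc k) ⟩
    suc k ∎

sum-replicate : ∀ k m → sum (replicate k m) ≡ k * m
sum-replicate zero    m = refl
sum-replicate (suc k) m = cong (_+_ m) (sum-replicate k m)

-- Enumeration by smallest part

-- The partitions with smallest part 1 ≤ m ≤ M of multiplicity k and the
-- larger parts among the first N admissible ones, of any sum.
candidates : ℕ → ℕ → ℕ → List (List ℕ)
candidates k N zero    = []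
candidates k N (suc m) = candidates k N m ++ map (_++ replicate k (suc m)) (chains (2 + m) N)

∈-candidates⁺ : ∀ {k N M m π} → m < M → π ∈ chains (2 + m) N → π ++ replicate k (suc m) ∈ candidates k N M
∈-candidates⁺ {k} {N} {suc M} {m} m<1+M π∈ with m ≟ M
... | yes refl = ∈-++⁺ʳ (candidates k N M) (∈-map⁺ (_++ replicate k (suc m)) π∈)
... | no m≢M   = ∈-++⁺ˡ (∈-candidates⁺ (ℕ.≤∧≢⇒< (ℕ.≤-pred m<1+M) m≢M) π∈)

∈-candidates⁻ : ∀ {k N} M {ρ} → ρ ∈ candidates k N M →
  ∃[ m ] ∃[ π ] m < M × π ∈ chains (2 + m) N × ρ ≡ π ++ replicate k (suc m)
∈-candidates⁻ {k} {N} (suc M) ρ∈ with ∈-++⁻ (candidates k N M) ρ∈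
... | inj₂ ρ∈ʳ with ∈-map⁻ (_++ replicate k (suc M)) ρ∈ʳ
...   | π , π∈ , eq = M , π , ℕ.n<1+n M , π∈ , eq
∈-candidates⁻ {k} {N} (suc M) ρ∈ | inj₁ ρ∈ˡ with ∈-candidates⁻ M ρ∈ˡ
...   | m , π , m<M , π∈ , eq = m , π , ℕ.m≤n⇒m≤1+n m<M , π∈ , eq

chains-> : ∀ m N {π} → π ∈ chains (suc m) N → All (m <_) π
chains-> m N π∈ = All.map (λ { (j , _ , refl) → ℕ.m≤m+n (suc m) (j * 2) }) (proj₂ (chains-sound (suc m) N π∈))

-- `smallest` recovers the smallest part, so different blocks are disjoint. This uses at least one
-- copy: with none, `[]` would lie in every block.
candidates-unique : ∀ k N M → Unique (candidates (suc k) N M)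
candidates-unique k N zero    = []
candidates-unique k N (suc M) = Unique.++⁺ (candidates-unique k N M)
  (Unique.map⁺ (λ {π} {ρ} → ++-cancelʳ (replicate (suc k) (suc M)) π ρ) (chains-unique (2 + M) N)) disjoint
  where
  disjoint : ∀ {ρ} → ρ ∈ candidates (suc k) N M × ρ ∈ map (_++ replicate (suc k) (suc M)) (chains (2 + M) N) → _
  disjoint (ρ∈ , ρ∈′) with ∈-candidates⁻ M ρ∈ | ∈-map⁻ (_++ replicate (suc k) (suc M)) ρ∈′
  ... | m , π , m<M , π∈ , refl | π′ , π′∈ , eq = ℕ.<-irrefl (ℕ.suc-injective (begin
      suc m ≡⟨ smallest-++-replicate k (chains-> (suc m) N π∈) ⟨
      smallest (π ++ replicate (suc k) (suc m)) ≡⟨ cong smallest eq ⟩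
      smallest (π′ ++ replicate (suc k) (suc M)) ≡⟨ smallest-++-replicate k (chains-> (suc M) N π′∈) ⟩
      suc M ∎)) m<M

largerSign : List ℕ → ℤ
largerSign π = sign (length (largerParts π))

genfun-candidates : ∀ k n M → genfun largerSign (candidates (suc k) (suc n) M) n ≡ upper (suc k) M n
genfun-candidates k n zero    = refl
genfun-candidates k n (suc m) = begin
  genfun largerSign (candidates (suc k) (suc n) m ++ map g C) n
    ≡⟨ genfun-++ largerSign (candidates (suc k) (suc n) m) (map g C) n ⟩
  genfun largerSign (candidates (suc k) (suc n) m) n ℤ.+ genfun largerSign (map g C) n
    ≡⟨ cong₂ ℤ._+_ (genfun-candidates k n m) (genfun-map c 1ℤ g largerSign (sign ∘ length) weights n) ⟩
  upper (suc k) m n ℤ.+ 1ℤ ℤ.* shift c (genfun (sign ∘ length) C) n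
    -- Only degrees i ≤ n enter, and there `suc n` admissible parts already give the infinite
    -- product.
    ≡⟨ cong (ℤ._+_ (upper (suc k) m n)) (trans (ℤ.*-identityˡ _) (shift-cong-≤ c n λ i i≤n →
         trans (genfun-chains (2 + m) (suc n) i) (prod-limit (2 + m) (s≤s i≤n)))) ⟩
  upper (suc k) (suc m) n ∎
  where
  C = chains (2 + m) (suc n)
  c = suc k * suc m
  g : List ℕ → List ℕ
  g = _++ replicate (suc k) (suc m)
  weights : All (λ π → sum (g π) ≡ c + sum π × largerSign (g π) ≡ 1ℤ ℤ.* sign (length π)) C
  weights = All.tabulate λ {π} π∈ →
    trans (sum-++ π (replicate (suc k) (suc m)))
      (trans (cong (_+_ (sum π)) (sum-replicate (suc k) (suc m))) (ℕ.+-comm (sum π) c)) ,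
    trans (cong (sign ∘ length) (largerParts-++-replicate k (chains-> (suc m) (suc n) π∈)))
      (sym (ℤ.*-identityˡ (sign (length π))))

-- Every counted partition is a candidate, and conversely

filter-≡-replicate : ∀ m π → filter (m ≟_) π ≡ replicate (multiplicity m π) m
filter-≡-replicate m []      = refl
filter-≡-replicate m (p ∷ π) with m ≟ p
... | yes refl = trans (filter-accept (m ≟_) refl) (trans (cong (m ∷_) (filter-≡-replicate m π))
                   (cong (λ ρ → replicate (length ρ) m) (sym (filter-accept (m ≟_) refl))))
... | no m≢p   = trans (filter-reject (m ≟_) m≢p) (trans (filter-≡-replicate m π)
                   (cong (λ ρ → replicate (length ρ) m) (sym (filter-reject (m ≟_) m≢p))))

-- Once the head equals the lower bound m, all later parts lie between m and m, so no larger part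
-- follows a copy of m.
decreasing-split : ∀ m π → AllPairs _≥_ π → All (m ≤_) π → π ≡ filter (m <?_) π ++ filter (m ≟_) π
decreasing-split m []      _          _           = refl
decreasing-split m (p ∷ π) (p≥ ∷ dec) (m≤p ∷ m≤π) with m ≟ p
... | no m≢p = begin
  p ∷ π                                          ≡⟨ cong (p ∷_) (decreasing-split m π dec m≤π) ⟩
  p ∷ filter (m <?_) π ++ filter (m ≟_) π
    ≡⟨ cong₂ _++_ (filter-accept (m <?_) (ℕ.≤∧≢⇒< m≤p m≢p)) (filter-reject (m ≟_) m≢p) ⟨
  filter (m <?_) (p ∷ π) ++ filter (m ≟_) (p ∷ π) ∎
... | yes refl = begin
  m ∷ π                                          ≡⟨ filter-all (m ≟_) (refl ∷ m≡π) ⟨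
  filter (m ≟_) (m ∷ π)
    ≡⟨ cong (_++ filter (m ≟_) (m ∷ π)) (filter-none (m <?_) (All.map (ℕ.<-irrefl) (refl ∷ m≡π))) ⟨
  filter (m <?_) (m ∷ π) ++ filter (m ≟_) (m ∷ π) ∎
  where
  m≡π : All (m ≡_) π
  m≡π = All.zipWith (λ (m≤x , x≤m) → ℕ.≤-antisym m≤x x≤m) (m≤π , p≥)

+-suc-suc : ∀ m n → m + (2 + n) ≡ 2 + (m + n)
+-suc-suc m n = trans (ℕ.+-suc m (suc n)) (cong suc (ℕ.+-suc m n))

-- With p = m + 1 + d, lowering d by two keeps the parity; d = 1 would give m + 2, which has the
-- parity of m.
opposite-parity : ∀ {m p} → m < p → parity p ≢ parity m → ∃[ j ] p ≡ suc m + j * 2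
opposite-parity {m} {p} m<p p≢m =
  subst (λ x → parity x ≢ parity m → ∃[ j ] x ≡ suc m + j * 2) (ℕ.m+[n∸m]≡n m<p) (go (p ∸ suc m)) p≢m
  where
  go : ∀ d → parity (suc m + d) ≢ parity m → ∃[ j ] suc m + d ≡ suc m + j * 2
  go zero          _   = 0 , refl
  go (suc zero)    neq = contradiction (cong parity (ℕ.+-comm (suc m) 1)) neq
  go (suc (suc d)) neq with go d (λ e → neq (trans (cong parity (+-suc-suc (suc m) d)) e))
  ... | j , eq = suc j , trans (+-suc-suc (suc m) d)
                           (trans (cong (_+_ 2) eq) (sym (+-suc-suc (suc m) (j * 2))))

parity-odd-gap : ∀ m j → parity (suc m + j * 2) ≢ parity m
parity-odd-gap m zero e = ℙ.p≢p⁻¹ (parity (suc m))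
  (trans (cong parity (sym (ℕ.+-identityʳ (suc m)))) (trans e (sym (ℙ.suc-homo-⁻¹ m))))
parity-odd-gap m (suc j) e = parity-odd-gap m j
  (trans (cong parity (sym (+-suc-suc (suc m) (j * 2)))) e)

SptDo⇒candidates : ∀ k n {π} → InSptDo (suc k) n π → π ∈ candidates (suc k) (suc n) n
-- In `[]` the default smallest part 0 has multiplicity 0, not `suc k`.
SptDo⇒candidates k n {[]} (mkInSptDo _ () _ _)
SptDo⇒candidates k n {p ∷ π} (mkInSptDo (mkIsPartition pos dec refl) mult distinct par) =
  result m refl m≥1
  where
  ρ = p ∷ π
  m = smallest ρ
  m≥1 : 1 ≤ m
  m≥1 = Extrema.v≤min⁺ (All.head pos) (All.tail pos)
  m≤ρ : All (m ≤_) ρ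
  m≤ρ = Extrema.min≤⊤ p π ∷ Extrema.min≤xs p π
  decreasing : AllPairs _≥_ ρ
  decreasing = Linked⇒AllPairs (λ a b → ℕ.≤-trans b a) dec
  ρ≡ : ρ ≡ largerParts ρ ++ replicate (suc k) m
  ρ≡ = trans (decreasing-split m ρ decreasing m≤ρ)
    (cong (largerParts ρ ++_) (trans (filter-≡-replicate m ρ) (cong (λ x → replicate x m) mult)))
  larger-decreasing : AllPairs _>_ (largerParts ρ)
  larger-decreasing = AllPairs.zipWith (λ (x≥y , x≢y) → ℕ.≤∧≢⇒< x≥y (x≢y ∘ sym))
    (AllPairs.filter⁺ (m <?_) decreasing , distinct)
  step : ∀ {x} → m < x → x ≤ sum ρ → parity x ≢ parity m → Step (suc m) (suc (sum ρ)) x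
  step m<x x≤n x≢m with opposite-parity m<x x≢m
  -- The index j is at most the part itself, hence at most n, so `suc n` admissible values cover all
  -- larger parts.
  ... | j , refl = j , s≤s (ℕ.≤-trans (ℕ.≤-trans (ℕ.m≤m*n j 2) (ℕ.m≤n+m (j * 2) (suc m))) x≤n) , refl
  steps : All (Step (suc m) (suc (sum ρ))) (largerParts ρ)
  steps = All.zipWith (λ ((m<x , x≤n) , x≢m) → step m<x x≤n x≢m)
    (All.zip (All.all-filter (m <?_) ρ , All.filter⁺ (m <?_) (parts≤sum ρ)) , par)
  -- `candidates` stores the smallest part as a successor. The computed minimum cannot be matched
  -- directly, so a variable equal to it is.
  result : ∀ m′ → m′ ≡ m → 1 ≤ m′ → ρ ∈ candidates (suc k) (suc (sum ρ)) (sum ρ)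
  result (suc m′) eq _ = subst (_∈ candidates (suc k) (suc (sum ρ)) (sum ρ)) (sym (trans ρ≡ (cong (λ x → largerParts ρ ++ replicate (suc k) x) (sym eq))))
    (∈-candidates⁺ {N = suc (sum ρ)} (subst (_≤ sum ρ) (sym eq) (ℕ.≤-trans (All.head m≤ρ) (All.head (parts≤sum ρ))))
      (chains-complete (2 + m′) (suc (sum ρ)) larger-decreasing
        (subst (λ x → All (Step (suc x) (suc (sum ρ))) (largerParts ρ)) (sym eq) steps)))

candidates⇒SptDo : ∀ k n N M {ρ} → ρ ∈ candidates (suc k) N M → sum ρ ≡ n → InSptDo (suc k) n ρ
candidates⇒SptDo k n N M ρ∈ sum≡ with ∈-candidates⁻ M ρ∈
... | m , π , _ , π∈ , refl with chains-sound (2 + m) N π∈ | chains-> (suc m) N π∈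
...   | dec , steps | m<π = mkInSptDo
  (mkIsPartition
    (All.++⁺ (All.map (ℕ.≤-trans (s≤s z≤n)) m<π) (All.replicate⁺ (suc k) (s≤s z≤n)))
    (AllPairs⇒Linked (AllPairs.++⁺ (AllPairs.map ℕ.<⇒≤ dec) (constant (suc k))
      (All.map (λ m<x → All.replicate⁺ (suc k) (ℕ.<⇒≤ m<x)) m<π)))
    sum≡)
  (multiplicity-++-replicate k m<π)
  (subst Unique (sym larger≡) (AllPairs.map ℕ.>⇒≢ dec))
  (subst₂ (λ xs s → All (λ x → parity x ≢ parity s) xs) (sym larger≡) (sym (smallest-++-replicate k m<π))
    (All.map (λ { (j , _ , refl) → parity-odd-gap (suc m) j }) steps))
  where
  larger≡ = largerParts-++-replicate k m<π
  constant : ∀ j → AllPairs _≥_ (replicate j (suc m))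
  constant zero    = []
  constant (suc j) = All.replicate⁺ j ℕ.≤-refl ∷ constant j

-- Duplicate-free lists with the same members are permutations of each other, so the two enumeration
-- orders are never compared.
SptDo-↭ : ∀ k n → SptDo (suc k) n ↭ filter (λ π → sum π ≟ n) (candidates (suc k) (suc n) n)
SptDo-↭ k n = ∼bag⇒↭ (unique∧set⇒bag
  (Unique.filter⁺ (inSptDo? (suc k) n) (partitions-unique n))
  (Unique.filter⁺ (λ π → sum π ≟ n) (candidates-unique k (suc n) n))
  (mk⇔ to from))
  where
  to : ∀ {π} → π ∈ SptDo (suc k) n → π ∈ filter (λ π → sum π ≟ n) (candidates (suc k) (suc n) n)
  to π∈ with ∈-filter⁻ (inSptDo? (suc k) n) {xs = partitions n} π∈
  ... | _ , inSpt = ∈-filter⁺ (λ π → sum π ≟ n) (SptDo⇒candidates k n inSpt)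
                      (IsPartition.sum≡n (InSptDo.isPartition inSpt))
  from : ∀ {π} → π ∈ filter (λ π → sum π ≟ n) (candidates (suc k) (suc n) n) → π ∈ SptDo (suc k) n
  from π∈ with ∈-filter⁻ (λ π → sum π ≟ n) {xs = candidates (suc k) (suc n) n} π∈
  ... | π∈C , sum≡ = ∈-filter⁺ (inSptDo? (suc k) n) (∈-partitions⁺ (InSptDo.isPartition inSpt)) inSpt
    where inSpt = candidates⇒SptDo k n (suc n) n π∈C sum≡

-- From the partition count to the closed form

spt′≡upper : ∀ k n → spt′ (suc k) n ≡ upper (suc k) n n
spt′≡upper k n = begin
  spt′ (suc k) n ≡⟨ even-odd-difference (length ∘ largerParts) (SptDo (suc k) n) ⟩
  total largerSign (SptDo (suc k) n) ≡⟨ total-↭ largerSign (SptDo-↭ k n) ⟩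
  total largerSign (filter (λ π → sum π ≟ n) (candidates (suc k) (suc n) n))
    ≡⟨ total-filter-sum largerSign (candidates (suc k) (suc n) n) n ⟩
  genfun largerSign (candidates (suc k) (suc n) n) n ≡⟨ genfun-candidates k n n ⟩
  upper (suc k) n n ∎

spt′-series≈upper : ∀ k n → spt′-series (suc k) n ≡ upper (suc k) n n
-- The series starts at n = 1, and `upper` with bound 0 is the empty sum.
spt′-series≈upper k zero    = refl
spt′-series≈upper k (suc n) = spt′≡upper k (suc n)

theorem2 : (k : ℕ) → 1 ≤ k →
    spt′-series k ≈ T k ⊗ poch∞ q (q ^^ 2) ⊕ (+ 2) · (q ^^ k ⊗ poch (q ^^ 2) (q ^^ 2) (k ∸ 1))
theorem2 (suc k) _ n = begin
  spt′-series (suc k) n ≡⟨ spt′-series≈upper k n ⟩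
  upper (suc k) n n ≡⟨ upper≡closed k {n} ℕ.≤-refl ⟩
  closed k n ≡⟨ closed≈ k n ⟩
  _ ∎
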